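{- For any $n \geq 0$, each equivalence class of $\mathfrak{S}_n /_{\equiv_{\mathrm{B}}}$ contains exactly one Baxter permutation.
   Context: $A = \{a_1 < a_2 < \cdots\}$ is a totally ordered infinite alphabet and $A^*$ is the free monoid of words on $A$. The Baxter congruence $\equiv_{\mathrm{B}}$ is the smallest congruence (equivalence relation compatible with concatenation) on $A^*$ such that, for all words $u, v \in A^*$ and letters $a,b,c,d \in A$: $\; c\,u\,a d\,v\,b \equiv_{\mathrm{B}} c\,u\,d a\,v\,b$ whenever $a \leq b < c \leq d$, and $\; b\,u\,d a\,v\,c \equiv_{\mathrm{B}} b\,u\,a d\,v\,c$ whenever $a < b \leq c < d$. $\mathfrak{S}_n$ is the set of permutations of size $n$, a permutation of size $n$ being seen as a word of length $n$ without repetition on the first $n$ letters of $A$ (identified with $1,\dots,n$); $\equiv_{\mathrm{B}}$ thus restricts to an equivalence relation on $\mathfrak{S}_n$. A permutation $\sigma$ is a Baxter permutation if for any subword $u_1u_2u_3u_4$ of $\sigma$ such that the letters $u_2$ and $u_3$ are adjacent in $\sigma$, $\mathrm{std}(u_1u_2u_3u_4) \notin \{2413, 3142\}$, where $\mathrm{std}(u)$ is the unique permutation of size $|u|$ having the same inversions as $u$. -}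

module Defs where

open import Data.Fin using (Fin; cast)
import Data.Fin as Fin
open import Data.List using (List; []; _∷_; _++_; length; lookup)
open import Data.List.Membership.Propositional using (_∉_)
open import Data.List.Relation.Binary.Sublist.Propositional using (_⊆_)
open import Data.List.Relation.Unary.All using (All)
open import Data.List.Relation.Unary.Unique.Propositional using (Unique)
open import Data.Nat using (ℕ; _<_; _>_; _≤_)
open import Data.Product using (Σ; ∃₂; _×_)
open import Function.Bundles using (_⇔_)
open import Relation.Binary.PropositionalEquality using (_≡_)

-- The alphabet {a₁ < a₂ < ⋯} is ℕ with its usual order, the number i standing
-- for a₍ᵢ₊₁₎; so the first n letters are 0, …, n - 1, and permutations are
-- written with letters starting from 0 rather than 1.
Letter : Set
Letter = ℕ

Word : Set
Word = List Letter

infix 4 _≡ᴮ_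

data _≡ᴮ_ : Word → Word → Set where
  swap₁ : ∀ (u v : Word) {a b c d : Letter} → a ≤ b → b < c → c ≤ d →
          c ∷ u ++ a ∷ d ∷ v ++ b ∷ [] ≡ᴮ c ∷ u ++ d ∷ a ∷ v ++ b ∷ []
  swap₂ : ∀ (u v : Word) {a b c d : Letter} → a < b → b ≤ c → c < d →
          b ∷ u ++ d ∷ a ∷ v ++ c ∷ [] ≡ᴮ b ∷ u ++ a ∷ d ∷ v ++ c ∷ []
  reflᴮ  : ∀ {u} → u ≡ᴮ u
  symᴮ   : ∀ {u v} → u ≡ᴮ v → v ≡ᴮ u
  transᴮ : ∀ {u v w} → u ≡ᴮ v → v ≡ᴮ w → u ≡ᴮ w
  congᴮ  : ∀ {u u′ v v′} → u ≡ᴮ u′ → v ≡ᴮ v′ → u ++ v ≡ᴮ u′ ++ v′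

IsPermutation : ℕ → Word → Set
IsPermutation n σ = length σ ≡ n × Unique σ × All (_< n) σ

-- Inversions are pairs of positions, not of letters.
Inversion : (u : Word) → Fin (length u) → Fin (length u) → Set
Inversion u i j = i Fin.< j × lookup u i > lookup u j

SameInversions : Word → Word → Set
SameInversions u v = Σ (length u ≡ length v) λ eq →
  ∀ i j → Inversion u i j ⇔ Inversion v (cast eq i) (cast eq j)

-- The graph of std:  IsStd u π  says  π = std(u).
IsStd : Word → Word → Set
IsStd u π = IsPermutation (length u) π × SameInversions u π

Adjacent : Letter → Letter → Word → Set
Adjacent x y σ = ∃₂ λ p s → σ ≡ p ++ x ∷ y ∷ s

-- 2413 and 3142, with letters starting from 0.
[2413] [3142] : Word
[2413] = 1 ∷ 3 ∷ 0 ∷ 2 ∷ []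
[3142] = 2 ∷ 0 ∷ 3 ∷ 1 ∷ []

-- _⊆_ is the (not necessarily contiguous) subword relation. Adjacent fixes the
-- order of u₂ and u₃, which is no restriction: in a word without repetition,
-- the subword already forces u₂ to come before u₃.
IsBaxter : Word → Set
IsBaxter σ = ∀ {u₁ u₂ u₃ u₄} →
  u₁ ∷ u₂ ∷ u₃ ∷ u₄ ∷ [] ⊆ σ → Adjacent u₂ u₃ σ →
  ∀ {π} → IsStd (u₁ ∷ u₂ ∷ u₃ ∷ u₄ ∷ []) π → π ∉ [2413] ∷ [3142] ∷ []

IsBaxterPermutation : ℕ → Word → Set
IsBaxterPermutation n σ = IsPermutation n σ × IsBaxter σ

{-# OPTIONS --safe #-}

-- On words without repetition, ≡ᴮ is generated by exchanging two adjacent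
-- letters l, r whenever some letter to their left and some letter to their
-- right lie strictly between them. Let n exceed all letters of p ++ q.
-- Existence: an exchange in p ++ q lifts to p ++ n ∷ q, because n itself can
-- always be moved out from between l and r; so by induction p ++ q may be taken
-- Baxter, and n can then be slid towards the maximum of p ++ q until it stands
-- just before a left-to-right maximum or just after a right-to-left maximum,
-- where it creates no forbidden pattern.
-- Uniqueness: erasing n respects both the equivalence and the Baxter property,
-- so by induction two equivalent Baxter words are p n t q and p t n q. Exchanges
-- preserve the sets of left-to-right and of right-to-left maxima. If t is
-- nonempty, then, comparing the two words, its first letter w is smaller than
-- some x in p, and its last letter z is smaller than some y in q; now x < y gives
-- 2-41-3 at n w in the first word, and y < x gives 3-14-2 at z n in the second.
module Submission where

open import Defs
open import Data.Empty using (⊥-elim)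
open import Data.Fin using (zero; suc; cast; #_)
import Data.Fin as Fin
open import Data.List using ([]; _∷_; _++_; _∷ʳ_; [_]; filter; length; lookup)
open import Data.Nat using (ℕ; zero; suc; _<_; _≤_; _>_; z<s; s<s; s≤s; _≟_; _<?_)
open import Data.Nat.Properties
open import Data.List.Extrema ≤-totalOrder using (max; argmax-all; ⊥≤max; xs≤max)
open import Data.List.Membership.Propositional using (_∈_; _∉_; find; lose)
open import Data.List.Membership.Propositional.Properties
  using (∈-++⁺ˡ; ∈-++⁺ʳ; ∈-++⁻; ∈-insert; ∈-∃++; ∈-filter⁺)
open import Data.List.Membership.DecPropositional using (_∈?_)
open import Data.List.Properties using
  (++-assoc; ++-identityʳ; ∷-injective; ∷ʳ-injectiveʳ;
  filter-++; filter-accept; filter-all; filter-reject)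
open import Data.List.Relation.Binary.Permutation.Propositional
  using (_↭_; ↭-refl; ↭-sym; ↭-trans; ↭-swap; ↭⇒↭ₛ)
open import Data.List.Relation.Binary.Permutation.Propositional.Properties
  using (++⁺; ++⁺ˡ; shift; All-resp-↭; ∈-resp-↭; ↭-length; ↭-empty-inv)
open import Data.List.Relation.Binary.Permutation.Setoid.Properties using (Unique-resp-↭)
open import Data.List.Relation.Binary.Sublist.Propositional
  using (_⊆_; []; _∷_; ⊆-trans; from∈; to∈; minimum)
  renaming (_∷ʳ_ to skip)
import Data.List.Relation.Binary.Sublist.Propositional.Properties as Sublist
open import Data.List.Relation.Unary.All as All using (All; []; _∷_)
import Data.List.Relation.Unary.All.Properties as All
open import Data.List.Relation.Unary.AllPairs using ([]; _∷_)
open import Data.List.Relation.Unary.Any using (here; there; any?)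
open import Data.List.Relation.Unary.Unique.Propositional using (Unique)
open import Data.List.Relation.Unary.Unique.DecPropositional _≟_ using (unique?)
open import Data.List.Relation.Binary.Pointwise using (Pointwise; []; _∷_)
open import Data.List.Reverse using (Reverse; []; _∶_∶ʳ_; reverseView)
open import Data.Product using (∃; ∃₂; ∃!; _×_; _,_; proj₁; proj₂; map₁)
open import Data.Sum using (_⊎_; inj₁; inj₂; [_,_]′)
open import Function using (_∘_; id)
open import Function.Bundles using (_⇔_; mk⇔; Equivalence)
open import Relation.Binary.Construct.Closure.ReflexiveTransitive
  using (Star; ε; _◅_; _◅◅_; gmap; return; reverse)
open import Relation.Binary.Definitions using (Tri; tri<; tri≈; tri>)
open import Relation.Binary.PropositionalEquality
  using (_≡_; _≢_; refl; sym; trans; cong; subst; subst₂; setoid; module ≡-Reasoning)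
open import Relation.Unary using (Decidable)
open import Relation.Nullary.Decidable using (from-yes; from-no)
open import Relation.Nullary using (¬_; yes; no; contradiction; ¬?)

private variable
  n l r w x y z : Letter
  p q s u v σ τ ρ : Word

-- Exchanges of adjacent letters.

Between : (a d x y : Letter) → Set
Between a d x y = (a < x × x < d) × (a < y × y < d)

infix 4 _⟶_ _⟶*_

-- Both defining relations of `≡ᴮ` in both directions: they differ only in the relative order of `x`
-- and `y`, which is left free here. The words enter through equations, so that a factorization can
-- be compared with another one by `cut`.
data _⟶_ (σ τ : Word) : Set where
  swap : ∀ p s → x ∈ p → y ∈ s → Between l r x y ⊎ Between r l x y →
         σ ≡ p ++ l ∷ r ∷ s → τ ≡ p ++ r ∷ l ∷ s → σ ⟶ τ

_⟶*_ : Word → Word → Set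
_⟶*_ = Star _⟶_

≡⇒⟶* : σ ≡ τ → σ ⟶* τ
≡⇒⟶* refl = ε

⟶-sym : σ ⟶ τ → τ ⟶ σ
⟶-sym (swap p s x∈p y∈s btw eq eq′) = swap p s x∈p y∈s ([ inj₂ , inj₁ ]′ btw) eq′ eq

⟶-++ʳ : ∀ v → σ ⟶ τ → σ ++ v ⟶ τ ++ v
⟶-++ʳ v (swap p s x∈p y∈s btw refl refl) =
  swap p (s ++ v) x∈p (∈-++⁺ˡ y∈s) btw (++-assoc p _ v) (++-assoc p _ v)

⟶-++ˡ : ∀ u → σ ⟶ τ → u ++ σ ⟶ u ++ τ
⟶-++ˡ u (swap p s x∈p y∈s btw refl refl) =
  swap (u ++ p) s (∈-++⁺ʳ u x∈p) y∈s btw (sym (++-assoc u p _)) (sym (++-assoc u p _))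

⟶⇒↭ : σ ⟶ τ → σ ↭ τ
⟶⇒↭ (swap p s _ _ _ refl refl) = ++⁺ˡ p (↭-swap _ _ ↭-refl)

⟶*⇒↭ : σ ⟶* τ → σ ↭ τ
⟶*⇒↭ ε        = ↭-refl
⟶*⇒↭ (t ◅ ts) = ↭-trans (⟶⇒↭ t) (⟶*⇒↭ ts)

≡ᴮ⇒↭ : σ ≡ᴮ τ → σ ↭ τ
≡ᴮ⇒↭ (swap₁ u v {c = c} _ _ _) = ++⁺ˡ (c ∷ u) (↭-swap _ _ ↭-refl)
≡ᴮ⇒↭ (swap₂ u v {b = b} _ _ _) = ++⁺ˡ (b ∷ u) (↭-swap _ _ ↭-refl)
≡ᴮ⇒↭ reflᴮ        = ↭-refl
≡ᴮ⇒↭ (symᴮ e)     = ↭-sym (≡ᴮ⇒↭ e)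
≡ᴮ⇒↭ (transᴮ e f) = ↭-trans (≡ᴮ⇒↭ e) (≡ᴮ⇒↭ f)
≡ᴮ⇒↭ (congᴮ e f)  = ++⁺ (≡ᴮ⇒↭ e) (≡ᴮ⇒↭ f)

-- Words without repetition, and the congruence as generated by exchanges.

unique-↭ : σ ↭ τ → Unique σ → Unique τ
unique-↭ = Unique-resp-↭ (setoid ℕ) ∘ ↭⇒↭ₛ

unique-++⁻ʳ : ∀ p → Unique (p ++ q) → Unique q
unique-++⁻ʳ []      uq       = uq
unique-++⁻ʳ (_ ∷ p) (_ ∷ uq) = unique-++⁻ʳ p uq

unique-++⁻ˡ : ∀ p → Unique (p ++ q) → Unique p
unique-++⁻ˡ []      _         = []
unique-++⁻ˡ (_ ∷ p) (≢s ∷ uq) = All.++⁻ˡ p ≢s ∷ unique-++⁻ˡ p uq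

unique-++⇒≢ : ∀ p → Unique (p ++ q) → x ∈ p → y ∈ q → x ≢ y
unique-++⇒≢ (_ ∷ p) (≢s ∷ _)  (here refl) y∈q = All.lookup ≢s (∈-++⁺ʳ p y∈q)
unique-++⇒≢ (_ ∷ p) (_ ∷ uq) (there x∈p) y∈q = unique-++⇒≢ p uq x∈p y∈q

unique-head-∉ : Unique (x ∷ q) → x ∉ q
unique-head-∉ (≢s ∷ _) x∈q = All.lookup ≢s x∈q refl

unique-drop-mid : ∀ p → Unique (p ++ n ∷ q) → n ∉ p ++ q × Unique (p ++ q)
unique-drop-mid {n} {q} p uq with unique-↭ (shift n p q) uq
... | uq′@(_ ∷ upq) = unique-head-∉ uq′ , upq

-- Absence of repetition makes `a ≤ b` and `c ≤ d` in `swap₁` strict. It passes to intermediate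
-- words because `≡ᴮ` only permutes letters.
≡ᴮ⇒⟶* : σ ≡ᴮ τ → Unique σ → σ ⟶* τ
≡ᴮ⇒⟶* (swap₁ u v {b = b} {c} a≤b b<c c≤d) uq =
  return (swap (c ∷ u) (v ∷ʳ b) (here refl) (∈-insert v)
    (inj₁ ((≤-<-trans a≤b b<c , c<d) , (a<b , <-≤-trans b<c c≤d))) refl refl)
  where
  a<b = ≤∧≢⇒< a≤b λ { refl → unique-head-∉ (unique-++⁻ʳ (c ∷ u) uq) (there (∈-insert v)) }
  c<d = ≤∧≢⇒< c≤d (unique-++⇒≢ (c ∷ u) uq (here refl) (there (here refl)))
≡ᴮ⇒⟶* (swap₂ u v {b = b} {c} a<b b≤c c<d) _ =
  return (swap (b ∷ u) (v ∷ʳ c) (here refl) (∈-insert v)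
    (inj₂ ((a<b , ≤-<-trans b≤c c<d) , (<-≤-trans a<b b≤c , c<d))) refl refl)
≡ᴮ⇒⟶* reflᴮ        _  = ε
≡ᴮ⇒⟶* (symᴮ e)     uq = reverse ⟶-sym (≡ᴮ⇒⟶* e (unique-↭ (↭-sym (≡ᴮ⇒↭ e)) uq))
≡ᴮ⇒⟶* (transᴮ e f) uq = ≡ᴮ⇒⟶* e uq ◅◅ ≡ᴮ⇒⟶* f (unique-↭ (≡ᴮ⇒↭ e) uq)
≡ᴮ⇒⟶* (congᴮ {u} {u′} {v} e f) uq =
  gmap (_++ v) (⟶-++ʳ v) (≡ᴮ⇒⟶* e (unique-++⁻ˡ u uq)) ◅◅
  gmap (u′ ++_) (⟶-++ˡ u′) (≡ᴮ⇒⟶* f (unique-++⁻ʳ u uq))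

-- A defining relation acts on the factor running from `x` to `y`, and congruence supplies the rest.
-- The order of `x` and `y` decides which relation it is.
ascent-≡ᴮ : ∀ p s → x ∈ p → y ∈ s → Between l r x y →
            p ++ l ∷ r ∷ s ≡ᴮ p ++ r ∷ l ∷ s
ascent-≡ᴮ {x} {y} {l} {r} p s x∈p y∈s ((l<x , x<r) , (l<y , y<r))
  with p₁ , p₂ , refl ← ∈-∃++ x∈p | s₁ , s₂ , refl ← ∈-∃++ y∈s =
  subst₂ _≡ᴮ_ (regroup l r) (regroup r l) (congᴮ (reflᴮ {p₁}) (congᴮ core (reflᴮ {s₂})))
  where
  core : x ∷ p₂ ++ l ∷ r ∷ s₁ ++ y ∷ [] ≡ᴮ x ∷ p₂ ++ r ∷ l ∷ s₁ ++ y ∷ []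
  core with y <? x
  ... | yes y<x = swap₁ p₂ s₁ (<⇒≤ l<y) y<x (<⇒≤ x<r)
  ... | no  y≮x = symᴮ (swap₂ p₂ s₁ l<x (≮⇒≥ y≮x) y<r)

  regroup : ∀ a b → p₁ ++ (x ∷ p₂ ++ a ∷ b ∷ s₁ ++ y ∷ []) ++ s₂
                  ≡ (p₁ ++ x ∷ p₂) ++ a ∷ b ∷ s₁ ++ y ∷ s₂
  regroup a b = begin
    p₁ ++ (x ∷ p₂ ++ a ∷ b ∷ s₁ ++ y ∷ []) ++ s₂
      ≡⟨ cong (λ t → p₁ ++ x ∷ t) (++-assoc p₂ _ s₂) ⟩
    p₁ ++ x ∷ p₂ ++ a ∷ b ∷ (s₁ ++ y ∷ []) ++ s₂
      ≡⟨ cong (λ t → p₁ ++ x ∷ p₂ ++ a ∷ b ∷ t) (++-assoc s₁ _ s₂) ⟩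
    p₁ ++ x ∷ p₂ ++ a ∷ b ∷ s₁ ++ y ∷ s₂
      ≡⟨ ++-assoc p₁ (x ∷ p₂) _ ⟨
    (p₁ ++ x ∷ p₂) ++ a ∷ b ∷ s₁ ++ y ∷ s₂ ∎
    where open ≡-Reasoning

⟶⇒≡ᴮ : σ ⟶ τ → σ ≡ᴮ τ
⟶⇒≡ᴮ (swap p s x∈p y∈s (inj₁ btw) refl refl) = ascent-≡ᴮ p s x∈p y∈s btw
⟶⇒≡ᴮ (swap p s x∈p y∈s (inj₂ btw) refl refl) = symᴮ (ascent-≡ᴮ p s x∈p y∈s btw)

⟶*⇒≡ᴮ : σ ⟶* τ → σ ≡ᴮ τ
⟶*⇒≡ᴮ ε        = reflᴮ
⟶*⇒≡ᴮ (t ◅ ts) = transᴮ (⟶⇒≡ᴮ t) (⟶*⇒≡ᴮ ts)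

-- Forbidden patterns and factorizations.

-- l r stand adjacent, x somewhere to their left and y somewhere to their right:
-- 3-14-2 in the first case, 2-41-3 in the second.
Bad : (l r x y : Letter) → Set
Bad l r x y = (l < y × y < x × x < r) ⊎ (r < x × x < y × y < l)

-- `IsBaxter` with standardization unfolded into inequalities and the adjacent pair displayed by a
-- factorization.
Baxter : Word → Set
Baxter σ = ∀ p {l r} s {x y} → σ ≡ p ++ l ∷ r ∷ s → x ∈ p → y ∈ s → ¬ Bad l r x y

-- Where the cut between p and q falls relative to the adjacent letters l r.
data Cut (p q P : Word) (l r : Letter) (S : Word) : Set where
  before : ∀ t → P ≡ p ++ t → q ≡ t ++ l ∷ r ∷ S → Cut p q P l r S
  within : p ≡ P ∷ʳ l → q ≡ r ∷ S → Cut p q P l r S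
  after  : ∀ t → p ≡ P ++ l ∷ r ∷ t → S ≡ t ++ q → Cut p q P l r S

cut : ∀ p P {S} → p ++ q ≡ P ++ l ∷ r ∷ S → Cut p q P l r S
cut []          P       eq   = before P refl eq
cut (_ ∷ [])    []      refl = within refl refl
cut (_ ∷ _ ∷ p) []      refl = after p refl refl
cut (_ ∷ p)     (_ ∷ P) eq with refl , eq′ ← ∷-injective eq | cut p P eq′
... | before t refl e = before t refl e
... | within refl e   = within refl e
... | after t refl e  = after t refl e

++-split : ∀ p p′ {q q′ : Word} → p ++ q ≡ p′ ++ q′ →
           ∃ λ t → (p′ ≡ p ++ t × q ≡ t ++ q′) ⊎ (p ≡ p′ ++ t × q′ ≡ t ++ q)
++-split []      p′       eq = p′ , inj₁ (refl , eq)
++-split (x ∷ p) []       eq = x ∷ p , inj₂ (refl , sym eq)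
++-split (_ ∷ p) (_ ∷ p′) eq with refl , eq′ ← ∷-injective eq | ++-split p p′ eq′
... | t , inj₁ (refl , e) = t , inj₁ (refl , e)
... | t , inj₂ (refl , e) = t , inj₂ (refl , e)

∈-weaken : ∀ p → x ∈ p ++ q → x ∈ p ++ n ∷ q
∈-weaken p = [ ∈-++⁺ˡ , ∈-++⁺ʳ p ∘ there ]′ ∘ ∈-++⁻ p

-- Erasing a letter.

≢? : ∀ n → Decidable (_≢ n)
≢? n x = ¬? (x ≟ n)

erase : Letter → Word → Word
erase n = filter (≢? n)

erase-mid : ∀ p q → erase n (p ++ n ∷ q) ≡ erase n (p ++ q)
erase-mid {n} p q = begin
  erase n (p ++ n ∷ q)         ≡⟨ filter-++ (≢? n) p (n ∷ q) ⟩
  erase n p ++ erase n (n ∷ q) ≡⟨ cong (erase n p ++_) (filter-reject (≢? n) (λ n≢n → n≢n refl)) ⟩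
  erase n p ++ erase n q       ≡⟨ filter-++ (≢? n) p q ⟨
  erase n (p ++ q)             ∎
  where open ≡-Reasoning

erase-mid₂ : ∀ p q → erase n (p ++ n ∷ x ∷ q) ≡ erase n (p ++ x ∷ n ∷ q)
erase-mid₂ {n} {x} p q = begin
  erase n (p ++ n ∷ x ∷ q)    ≡⟨ erase-mid p (x ∷ q) ⟩
  erase n (p ++ x ∷ q)        ≡⟨ cong (erase n) (++-assoc p [ x ] q) ⟨
  erase n ((p ∷ʳ x) ++ q)     ≡⟨ erase-mid (p ∷ʳ x) q ⟨
  erase n ((p ∷ʳ x) ++ n ∷ q) ≡⟨ cong (erase n) (++-assoc p [ x ] (n ∷ q)) ⟩
  erase n (p ++ x ∷ n ∷ q)    ∎
  where open ≡-Reasoning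

erase-keep₂ : ∀ p q → x ≢ n → y ≢ n → erase n (p ++ x ∷ y ∷ q) ≡ erase n p ++ x ∷ y ∷ erase n q
erase-keep₂ {x} {n} {y} p q x≢n y≢n = begin
  erase n (p ++ x ∷ y ∷ q)         ≡⟨ filter-++ (≢? n) p (x ∷ y ∷ q) ⟩
  erase n p ++ erase n (x ∷ y ∷ q) ≡⟨ cong (erase n p ++_) (filter-accept (≢? n) x≢n) ⟩
  erase n p ++ x ∷ erase n (y ∷ q) ≡⟨ cong (λ t → erase n p ++ x ∷ t) (filter-accept (≢? n) y≢n) ⟩
  erase n p ++ x ∷ y ∷ erase n q   ∎
  where open ≡-Reasoning

erase-max : ∀ p → All (_< n) (p ++ q) → erase n (p ++ n ∷ q) ≡ p ++ q
erase-max {n} p <n = trans (erase-mid p _) (filter-all (≢? n) (All.map <⇒≢ <n))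

-- If `n` is one of the exchanged letters, the exchange becomes invisible. Otherwise `x` and `y`,
-- lying below the larger of `l` and `r`, differ from `n` and survive as witnesses.
erase-⟶ : All (_≤ n) σ → σ ⟶ τ → erase n σ ⟶* erase n τ
erase-⟶ {n} ≤n (swap {x} {y} {l} {r} p s x∈p y∈s btw refl refl) with l ≟ n | r ≟ n
... | yes refl | _        = ≡⇒⟶* (erase-mid₂ p s)
... | no _     | yes refl = ≡⇒⟶* (sym (erase-mid₂ p s))
... | no l≢n   | no r≢n   =
  return (swap (erase n p) (erase n s) (∈-filter⁺ (≢? n) x∈p (<⇒≢ x<n)) (∈-filter⁺ (≢? n) y∈s (<⇒≢ y<n)) btw
    (erase-keep₂ p s l≢n r≢n) (erase-keep₂ p s r≢n l≢n))
  where
  ≤n′ = All.++⁻ʳ p ≤n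
  l≤n = All.head ≤n′
  r≤n = All.head (All.tail ≤n′)
  x<n : x < n
  x<n = [ (λ b → <-≤-trans (proj₂ (proj₁ b)) r≤n) , (λ b → <-≤-trans (proj₂ (proj₁ b)) l≤n) ]′ btw
  y<n : y < n
  y<n = [ (λ b → <-≤-trans (proj₂ (proj₂ b)) r≤n) , (λ b → <-≤-trans (proj₂ (proj₂ b)) l≤n) ]′ btw

erase-⟶* : All (_≤ n) σ → σ ⟶* τ → erase n σ ⟶* erase n τ
erase-⟶* ≤n ε        = ε
erase-⟶* ≤n (t ◅ ts) = erase-⟶ ≤n t ◅◅ erase-⟶* (All-resp-↭ (⟶⇒↭ t) ≤n) ts

-- Inserting and removing a greatest letter; existence.

insert-⟶ : ∀ p → All (_< n) (p ++ q) → p ++ q ⟶ τ →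
           ∃₂ λ p′ q′ → τ ≡ p′ ++ q′ × p ++ n ∷ q ⟶* p′ ++ n ∷ q′
insert-⟶ {n} {q} p <n (swap {x} {y} {l} {r} P S x∈P y∈S btw eq refl) with cut p P eq
... | before t refl refl =
  p , t ++ r ∷ l ∷ S , ++-assoc p t _ ,
  return (swap (p ++ n ∷ t) S (∈-weaken p x∈P) y∈S btw (sym (++-assoc p _ _)) (sym (++-assoc p _ _)))
... | after t refl refl =
  P ++ r ∷ l ∷ t , q , sym (++-assoc P _ q) ,
  return (swap P (t ++ n ∷ q) x∈P (∈-weaken t y∈S) btw (++-assoc P _ _) (++-assoc P _ _))
... | within refl refl = around btw
  where
  <n′ = subst (All (_< n)) (++-assoc P [ l ] (r ∷ S)) <n
  x<n : x < n
  x<n = All.lookup <n′ (∈-++⁺ˡ x∈P)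
  y<n : y < n
  y<n = All.lookup <n′ (∈-++⁺ʳ P (there (there y∈S)))
  around : Between l r x y ⊎ Between r l x y →
           ∃₂ λ p′ q′ → P ++ r ∷ l ∷ S ≡ p′ ++ q′ × (P ∷ʳ l) ++ n ∷ r ∷ S ⟶* p′ ++ n ∷ q′
  -- `n` first leaves the gap past the smaller of `l` and `r`: `x` and `y` lie strictly between that
  -- letter and `n`, so they witness this exchange as well.
  around btw@(inj₁ ((l<x , _) , (l<y , _))) = P , r ∷ l ∷ S , refl ,
    swap P (r ∷ S) x∈P (there y∈S) (inj₁ ((l<x , x<n) , (l<y , y<n))) (++-assoc P _ _) refl ◅
    swap (P ∷ʳ n) S (∈-++⁺ˡ x∈P) y∈S btw (sym (++-assoc P _ _)) (sym (++-assoc P _ _)) ◅ ε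
  around btw@(inj₂ ((r<x , _) , (r<y , _))) = P ++ r ∷ l ∷ [] , S , sym (++-assoc P _ _) ,
    swap (P ∷ʳ l) S (∈-++⁺ˡ x∈P) y∈S (inj₂ ((r<x , x<n) , (r<y , y<n))) refl refl ◅
    swap P (n ∷ S) x∈P (there y∈S) btw (++-assoc P _ _) (++-assoc P _ _) ◅ ε

insert-⟶* : ∀ p → All (_< n) (p ++ q) → σ ≡ p ++ q → σ ⟶* τ →
            ∃₂ λ p′ q′ → τ ≡ p′ ++ q′ × p ++ n ∷ q ⟶* p′ ++ n ∷ q′
insert-⟶* p <n eq   ε        = p , _ , eq , ε
insert-⟶* p <n refl (t ◅ ts) with p₁ , q₁ , refl , us ← insert-⟶ p <n t
  with p₂ , q₂ , eq , vs ← insert-⟶* p₁ (All-resp-↭ (⟶⇒↭ t) <n) refl ts = p₂ , q₂ , eq , us ◅◅ vs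

-- A pattern created by removing `n` has its adjacent letters on either side of the gap. Putting `n`
-- in place of the larger one gives a pattern in the original word.
Baxter-remove-max : ∀ p → All (_< n) (p ++ q) → Baxter (p ++ n ∷ q) → Baxter (p ++ q)
Baxter-remove-max {n} {q} p <n bx P S {x} {y} eq x∈P y∈S bad with cut p P eq
... | before t refl refl = bx (p ++ n ∷ t) S (sym (++-assoc p _ _)) (∈-weaken p x∈P) y∈S bad
... | after t refl refl  = bx P (t ++ n ∷ q) (++-assoc P _ _) x∈P (∈-weaken t y∈S) bad
... | within refl refl with bad
...   | inj₁ (l<y , y<x , x<r) = bx P (_ ∷ S) (++-assoc P _ _) x∈P (there y∈S) (inj₁ (l<y , y<x , x<n))
  where x<n = All.lookup <n (∈-++⁺ˡ (∈-++⁺ˡ x∈P))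
...   | inj₂ (r<x , x<y , y<l) = bx (P ∷ʳ _) S refl (∈-++⁺ˡ x∈P) y∈S (inj₂ (r<x , x<y , y<n))
  where y<n = All.lookup <n (∈-++⁺ʳ (P ∷ʳ _) (there y∈S))

-- In a pattern `n` can only be the 4, which belongs to the adjacent pair. The two side conditions
-- exclude 2-41-3 with `n w` in the middle and 3-14-2 with `z n` in the middle.
Baxter-insert-max : ∀ p → All (_< n) (p ++ q) → Baxter (p ++ q) →
  (∀ {w s x y} → q ≡ w ∷ s → x ∈ p → y ∈ s → ¬ (w < x × x < y)) →
  (∀ {s z x y} → p ≡ s ∷ʳ z → x ∈ s → y ∈ q → ¬ (z < y × y < x)) →
  Baxter (p ++ n ∷ q)
Baxter-insert-max {n} {q} p <n bx okʳ okˡ P S {x} {y} eq x∈P y∈S bad with cut p P eq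
-- `within` makes `n` the letter `r`, and `before []` makes it `l`. In the remaining cases `n` would
-- have to be an outer letter, or the pattern already occurs in `p ++ q`.
... | within refl refl = [ (λ (l<y , y<x , _) → okˡ refl x∈P y∈S (l<y , y<x))
                         , (λ (n<x , _) → <-asym n<x (All.lookup <n (∈-++⁺ˡ (∈-++⁺ˡ x∈P)))) ]′ bad
... | before [] refl refl = [ (λ (n<y , _) → <-asym n<y (All.lookup <n (∈-++⁺ʳ p (there y∈S))))
                            , (λ (r<x , x<y , _) → okʳ refl (subst (x ∈_) (++-identityʳ p) x∈P) y∈S (r<x , x<y)) ]′ bad
... | before (_ ∷ t) refl refl with ∈-++⁻ p x∈P
...   | inj₁ x∈p = bx (p ++ t) S (sym (++-assoc p t _)) (∈-++⁺ˡ x∈p) y∈S bad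
...   | inj₂ (there x∈t) = bx (p ++ t) S (sym (++-assoc p t _)) (∈-++⁺ʳ p x∈t) y∈S bad
...   | inj₂ (here refl) = [ (λ (_ , _ , n<r) → <-asym n<r (<q (there (here refl))))
                           , (λ (_ , n<y , _) → <-asym n<y (<q (there (there y∈S)))) ]′ bad
  where
  <q : ∀ {z} → z ∈ _ ∷ _ ∷ S → z < n
  <q z∈ = All.lookup <n (∈-++⁺ʳ p (∈-++⁺ʳ t z∈))
Baxter-insert-max {n} {q} p <n bx okʳ okˡ P S {x} {y} eq x∈P y∈S bad | after t refl refl with ∈-++⁻ t y∈S
...   | inj₁ y∈t = bx P (t ++ q) (++-assoc P _ _) x∈P (∈-++⁺ˡ y∈t) bad
...   | inj₂ (there y∈q) = bx P (t ++ q) (++-assoc P _ _) x∈P (∈-++⁺ʳ t y∈q) bad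
...   | inj₂ (here refl) = [ (λ (_ , n<x , _) → <-asym n<x (<p (∈-++⁺ˡ x∈P)))
                           , (λ (_ , _ , n<l) → <-asym n<l (<p (∈-++⁺ʳ P (here refl)))) ]′ bad
  where
  <p : ∀ {z} → z ∈ P ++ _ ∷ _ ∷ t → z < n
  <p z∈ = All.lookup <n (∈-++⁺ˡ z∈)

-- As long as some `x` in `p` exceeds `w`, this `x` and the maximum `m` further right witness the
-- exchange of `n` and `w`. The slide stops at `m` at the latest.
slide-max-right : ∀ p q {m} → ρ ≡ p ++ q → Unique ρ → All (_< n) ρ → Baxter ρ →
                  m ∈ q → All (_≤ m) ρ → ∃ λ τ → p ++ n ∷ q ⟶* τ × Baxter τ
slide-max-right {n = n} p (w ∷ s) {m} refl uq <n bx m∈q ≤m with any? (w <?_) p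
... | no ∄x = p ++ n ∷ w ∷ s , ε , Baxter-insert-max p <n bx
      (λ { refl x∈p _ (w<x , _) → <⇒≱ w<x (p≤w x∈p) }) ok
  where
  p≤w : ∀ {x} → x ∈ p → x ≤ w
  p≤w x∈p = ≮⇒≥ λ w<x → ∄x (lose x∈p w<x)
  ok : ∀ {s′ z x y} → p ≡ s′ ∷ʳ z → x ∈ s′ → y ∈ w ∷ s → ¬ (z < y × y < x)
  ok refl x∈s′ (here refl) (_ , w<x) = <⇒≱ w<x (p≤w (∈-++⁺ˡ x∈s′))
  -- A 3-14-2 around `z n` would already be one around `z w` in `ρ`, since `w` exceeds `x`.
  ok {s′} refl x∈s′ (there y∈s) (z<y , y<x) =
    bx s′ s (++-assoc s′ _ _) x∈s′ y∈s (inj₁ (z<y , y<x , x<w))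
    where x<w = ≤∧≢⇒< (p≤w (∈-++⁺ˡ x∈s′)) (unique-++⇒≢ p uq (∈-++⁺ˡ x∈s′) (here refl))
... | yes ∃x with x , x∈p , w<x ← find ∃x | m∈q
...   | here refl = contradiction w<x (≤⇒≯ (All.lookup ≤m (∈-++⁺ˡ x∈p)))
...   | there m∈s
      with τ , ts , bxτ ← slide-max-right (p ∷ʳ w) s (sym (++-assoc p _ _)) uq <n bx m∈s ≤m =
  τ , swap p s x∈p m∈s (inj₂ ((w<x , x<n) , (<-≤-trans w<x x≤m , m<n))) refl (++-assoc p _ _) ◅ ts , bxτ
  where
  x<n = All.lookup <n (∈-++⁺ˡ x∈p)
  x≤m = All.lookup ≤m (∈-++⁺ˡ x∈p)
  m<n = All.lookup <n (∈-++⁺ʳ p (there m∈s))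

-- Mirror image of `slide-max-right`; `Reverse p` makes recursion on the last letter of `p`
-- structural.
slide-max-left : ∀ {p} → Reverse p → ∀ q {m} → ρ ≡ p ++ q → Unique ρ → All (_< n) ρ → Baxter ρ →
                 m ∈ p → All (_≤ m) ρ → ∃ λ τ → p ++ n ∷ q ⟶* τ × Baxter τ
slide-max-left {n = n} (p ∶ rp ∶ʳ z) q {m} refl uq <n bx m∈p ≤m with any? (z <?_) q
... | no ∄y = (p ∷ʳ z) ++ n ∷ q , ε , Baxter-insert-max (p ∷ʳ z) <n bx ok
      λ eq _ y∈q (z<y , _) → <⇒≱ z<y (subst (_ ≤_) (∷ʳ-injectiveʳ _ _ eq) (q≤z y∈q))
  where
  q≤z : ∀ {y} → y ∈ q → y ≤ z
  q≤z y∈q = ≮⇒≥ λ z<y → ∄y (lose y∈q z<y)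
  ok : ∀ {w s x y} → q ≡ w ∷ s → x ∈ p ∷ʳ z → y ∈ s → ¬ (w < x × x < y)
  ok {w} {s} {x} {y} refl x∈ y∈s (w<x , x<y) with ∈-++⁻ p x∈
  ... | inj₂ (here refl) = <⇒≱ x<y (q≤z (there y∈s))
  -- Here `z` takes over the role of 4 from `n` in 2-41-3.
  ... | inj₁ x∈p = bx p s (++-assoc p _ _) x∈p y∈s (inj₂ (w<x , x<y , y<z))
    where
    y<z = ≤∧≢⇒< (q≤z (there y∈s))
            (unique-++⇒≢ (p ∷ʳ z) uq (∈-++⁺ʳ p (here refl)) (there y∈s) ∘ sym)
... | yes ∃y with y , y∈q , z<y ← find ∃y | ∈-++⁻ p m∈p
...   | inj₂ (here refl) = contradiction z<y (≤⇒≯ (All.lookup ≤m (∈-++⁺ʳ (p ∷ʳ z) y∈q)))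
...   | inj₁ m∈p′
      with τ , ts , bxτ ← slide-max-left rp (z ∷ q) (++-assoc p _ _) uq <n bx m∈p′ ≤m =
  τ , swap p q m∈p′ y∈q (inj₁ ((<-≤-trans z<y y≤m , m<n) , (z<y , y<n))) (++-assoc p _ _) refl ◅ ts , bxτ
  where
  y<n = All.lookup <n (∈-++⁺ʳ (p ∷ʳ z) y∈q)
  y≤m = All.lookup ≤m (∈-++⁺ʳ (p ∷ʳ z) y∈q)
  m<n = All.lookup <n (∈-++⁺ˡ m∈p)

maximum-∈ : ∀ x p → max x p ∈ x ∷ p × All (_≤ max x p) (x ∷ p)
maximum-∈ x p = argmax-all id (here refl) (All.tabulate there) , ⊥≤max x p ∷ xs≤max x p

insert-max-Baxter : ∀ p q → ρ ≡ p ++ q → Unique ρ → All (_< n) ρ → Baxter ρ →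
                    ∃ λ τ → p ++ n ∷ q ⟶* τ × Baxter τ
insert-max-Baxter {ρ = []} [] [] refl _ _ _ =
  [ _ ] , ε , λ { [] _ _ () ; (_ ∷ []) _ () ; (_ ∷ _ ∷ _) _ () }
insert-max-Baxter {ρ = x ∷ ρ} p q eq uq <n bx with m∈ , ≤m ← maximum-∈ x ρ
  with ∈-++⁻ p (subst (_ ∈_) eq m∈)
... | inj₁ m∈p = slide-max-left (reverseView p) q eq uq <n bx m∈p ≤m
... | inj₂ m∈q = slide-max-right p q eq uq <n bx m∈q ≤m

<suc⇒< : All (_< suc n) σ → n ∉ σ → All (_< n) σ
<suc⇒< []        _   = []
<suc⇒< (s≤s x≤n ∷ ≤n) n∉σ = ≤∧≢⇒< x≤n (λ { refl → n∉σ (here refl) }) ∷ <suc⇒< ≤n (n∉σ ∘ there)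

-- Induction on a strict bound for the letters rather than on the length: if the greatest admissible
-- letter is absent, the bound merely drops.
Baxter-exists : ∀ n → Unique σ → All (_< n) σ → ∃ λ τ → σ ⟶* τ × Baxter τ
Baxter-exists zero    _  []  = [] , ε , λ { [] _ () ; (_ ∷ _) _ () }
Baxter-exists {σ} (suc n) uq <1+n with _∈?_ _≟_ n σ
... | no n∉σ  = Baxter-exists n uq (<suc⇒< <1+n n∉σ)
... | yes n∈σ
  with p , q , refl ← ∈-∃++ n∈σ
  with n∉pq , uq′ ← unique-drop-mid p uq
  with <n ← <suc⇒< (All.tail (All-resp-↭ (shift n p q) <1+n)) n∉pq
  with ρ , ts , bx ← Baxter-exists n uq′ <n
  with p′ , q′ , refl , us ← insert-⟶* p <n refl ts
  with τ , vs , bxτ ← insert-max-Baxter p′ q′ refl (unique-↭ (⟶*⇒↭ ts) uq′) (All-resp-↭ (⟶*⇒↭ ts) <n) bx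
  = τ , us ◅◅ vs , bxτ

-- Left-to-right and right-to-left maxima under exchanges.

unique-⊆⇒∈ˡ : ∀ p → Unique (p ++ w ∷ s) → x ∷ w ∷ [] ⊆ p ++ w ∷ s → x ∈ p
unique-⊆⇒∈ˡ [] uq (skip _ xw⊆s) = contradiction (to∈ (Sublist.∷ˡ⁻ xw⊆s)) (unique-head-∉ uq)
unique-⊆⇒∈ˡ [] uq (refl ∷ w⊆s)  = contradiction (to∈ w⊆s) (unique-head-∉ uq)
unique-⊆⇒∈ˡ (_ ∷ p) (_ ∷ uq) (skip _ xw⊆) = there (unique-⊆⇒∈ˡ p uq xw⊆)
unique-⊆⇒∈ˡ (_ ∷ p) _        (refl ∷ _)   = here refl

unique-⊆⇒∈ʳ : ∀ p → Unique (p ++ z ∷ s) → z ∷ y ∷ [] ⊆ p ++ z ∷ s → y ∈ s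
unique-⊆⇒∈ʳ [] uq (skip _ zy⊆s) = contradiction (to∈ zy⊆s) (unique-head-∉ uq)
unique-⊆⇒∈ʳ [] uq (refl ∷ y⊆s)  = to∈ y⊆s
unique-⊆⇒∈ʳ (_ ∷ p) (_ ∷ uq) (skip _ zy⊆) = unique-⊆⇒∈ʳ p uq zy⊆
unique-⊆⇒∈ʳ (_ ∷ p) uq       (refl ∷ _)   = contradiction (∈-insert p) (unique-head-∉ uq)

pair-⊆ : ∀ p → x ∈ p → y ∈ q → x ∷ y ∷ [] ⊆ p ++ q
pair-⊆ p x∈p y∈q = Sublist.++⁺ (from∈ x∈p) (from∈ y∈q)

swap-pair-⊆ : ∀ p → x ∷ y ∷ [] ⊆ p ++ l ∷ r ∷ s → (x ≡ l × y ≡ r) ⊎ x ∷ y ∷ [] ⊆ p ++ r ∷ l ∷ s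
swap-pair-⊆ [] (skip _ (skip _ xy⊆s)) = inj₂ (skip _ (skip _ xy⊆s))
swap-pair-⊆ [] (skip _ (refl ∷ y⊆s))  = inj₂ (refl ∷ skip _ y⊆s)
swap-pair-⊆ [] (refl ∷ skip _ y⊆s)    = inj₂ (skip _ (refl ∷ y⊆s))
swap-pair-⊆ [] (refl ∷ refl ∷ _)      = inj₁ (refl , refl)
swap-pair-⊆ (c ∷ p) (skip _ xy⊆) with swap-pair-⊆ p xy⊆
... | inj₁ eqs  = inj₁ eqs
... | inj₂ xy⊆′ = inj₂ (skip c xy⊆′)
swap-pair-⊆ (c ∷ p) (refl ∷ y⊆) = inj₂ (refl ∷ from∈ (∈-resp-↭ (++⁺ˡ p (↭-swap _ _ ↭-refl)) (to∈ y⊆)))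

-- w is not a left-to-right maximum of σ, respectively z is not a right-to-left
-- maximum of σ.
DominatedˡIn DominatedʳIn : Letter → Word → Set
DominatedˡIn w σ = ∃ λ x → w < x × x ∷ w ∷ [] ⊆ σ
DominatedʳIn z σ = ∃ λ y → z < y × z ∷ y ∷ [] ⊆ σ

-- Only the exchanged pair changes its relative order. If `l` was what dominated `r`, then the left
-- witness of the exchange, also greater than `r`, takes its place.
dominatedˡ-⟶ : σ ⟶ τ → DominatedˡIn w σ → DominatedˡIn w τ
dominatedˡ-⟶ (swap p s x∈p _ btw refl refl) (x , w<x , xw⊆) with swap-pair-⊆ p xw⊆ | btw
... | inj₂ xw⊆′          | _                  = x , w<x , xw⊆′
... | inj₁ (refl , refl) | inj₁ ((l<x , x<r) , _) = contradiction (<-trans l<x x<r) (<-asym w<x)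
... | inj₁ (refl , refl) | inj₂ ((r<x , _) , _)   = _ , r<x , pair-⊆ p x∈p (here refl)

dominatedʳ-⟶ : σ ⟶ τ → DominatedʳIn z σ → DominatedʳIn z τ
dominatedʳ-⟶ (swap {l = l} p s _ y∈s btw refl refl) (y , z<y , zy⊆) with swap-pair-⊆ p zy⊆ | btw
... | inj₂ zy⊆′          | _                    = y , z<y , zy⊆′
... | inj₁ (refl , refl) | inj₁ (_ , (l<y , _)) = _ , l<y , Sublist.++⁺ˡ p (skip _ (refl ∷ from∈ y∈s))
... | inj₁ (refl , refl) | inj₂ (_ , (r<y , y<l)) = contradiction (<-trans r<y y<l) (<-asym z<y)

⟶*-preserves : ∀ {P : Word → Set} → (∀ {σ τ} → σ ⟶ τ → P σ → P τ) → σ ⟶* τ → P σ → P τ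
⟶*-preserves f ε        Pσ = Pσ
⟶*-preserves f (t ◅ ts) Pσ = ⟶*-preserves f ts (f t Pσ)

∷-as-∷ʳ : ∀ (x : Letter) p → ∃₂ λ q y → x ∷ p ≡ q ∷ʳ y
∷-as-∷ʳ x []      = [] , x , refl
∷-as-∷ʳ x (y ∷ p) with q , z , eq ← ∷-as-∷ʳ y p = x ∷ q , z , cong (x ∷_) eq

-- Uniqueness: the position of the greatest letter.

Baxter-max-position : ∀ p t q → Unique (p ++ n ∷ t ++ q) → All (_< n) (p ++ t ++ q) →
                      p ++ n ∷ t ++ q ⟶* p ++ t ++ n ∷ q →
                      Baxter (p ++ n ∷ t ++ q) → Baxter (p ++ t ++ n ∷ q) → t ≡ []
Baxter-max-position p [] q _ _ _ _ _ = refl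
Baxter-max-position {n} p (w ∷ t₁) q uq <n ts bxσ bxτ
  with t₂ , z , eq ← ∷-as-∷ʳ w t₁
  -- In the first word `n` dominates `w` from the left. In the second only letters of `p` precede
  -- `w`, so the dominating `x` found there lies in `p`.
  with x , w<x , xw⊆τ ← ⟶*-preserves {P = DominatedˡIn w} dominatedˡ-⟶ ts
    (n , All.lookup <n (∈-++⁺ʳ p (here refl)) , Sublist.++⁺ˡ p (refl ∷ refl ∷ minimum _))
  -- Symmetrically, read from the second word back to the first, where only letters of `q` follow
  -- `z`.
  with y , z<y , zy⊆σ ← ⟶*-preserves {P = DominatedʳIn z} dominatedʳ-⟶ (reverse ⟶-sym ts)
    (n , All.lookup <n (∈-++⁺ʳ p (∈-++⁺ˡ (subst (z ∈_) (sym eq) (∈-insert t₂))))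
       , Sublist.++⁺ˡ p (pair-⊆ (w ∷ t₁) (subst (z ∈_) (sym eq) (∈-insert t₂)) (here refl)))
  = ⊥-elim (compare (<-cmp x y))
  where
  regroup : ∀ u v → u ++ w ∷ t₁ ++ v ≡ (u ++ t₂) ++ z ∷ v
  regroup u v = begin
    u ++ (w ∷ t₁) ++ v  ≡⟨ cong (λ t → u ++ t ++ v) eq ⟩
    u ++ (t₂ ∷ʳ z) ++ v ≡⟨ cong (u ++_) (++-assoc t₂ _ v) ⟩
    u ++ t₂ ++ z ∷ v    ≡⟨ ++-assoc u t₂ _ ⟨
    (u ++ t₂) ++ z ∷ v  ∎
    where open ≡-Reasoning
  σ≡ : p ++ n ∷ w ∷ t₁ ++ q ≡ ((p ∷ʳ n) ++ t₂) ++ z ∷ q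
  σ≡ = trans (sym (++-assoc p _ _)) (regroup (p ∷ʳ n) q)
  x∈p : x ∈ p
  x∈p = unique-⊆⇒∈ˡ p (unique-↭ (⟶*⇒↭ ts) uq) xw⊆τ
  y∈q : y ∈ q
  y∈q = unique-⊆⇒∈ʳ ((p ∷ʳ n) ++ t₂) (subst Unique σ≡ uq) (subst (_ ⊆_) σ≡ zy⊆σ)
  x<n = All.lookup <n (∈-++⁺ˡ x∈p)
  y<n = All.lookup <n (∈-++⁺ʳ p (∈-++⁺ʳ (w ∷ t₁) y∈q))
  compare : ¬ Tri (x < y) (x ≡ y) (y < x)
  compare (tri< x<y _ _) = bxσ p (t₁ ++ q) refl x∈p (∈-++⁺ʳ t₁ y∈q) (inj₂ (w<x , x<y , y<n))
  compare (tri≈ _ x≡y _) = unique-++⇒≢ p uq x∈p (there (there (∈-++⁺ʳ t₁ y∈q))) x≡y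
  compare (tri> _ _ y<x) = bxτ (p ++ t₂) q (regroup p (n ∷ q)) (∈-++⁺ˡ x∈p) y∈q (inj₁ (z<y , y<x , x<n))

Baxter-unique : ∀ n → Unique σ → All (_< n) σ → σ ⟶* τ → Baxter σ → Baxter τ → σ ≡ τ
Baxter-unique zero uq [] ts _ _ = sym (↭-empty-inv (↭-sym (⟶*⇒↭ ts)))
Baxter-unique {σ} (suc n) uq <1+n ts bxσ bxτ with _∈?_ _≟_ n σ
... | no n∉σ  = Baxter-unique n uq (<suc⇒< <1+n n∉σ) ts bxσ bxτ
... | yes n∈σ
  with p , q , refl ← ∈-∃++ n∈σ
  with p′ , q′ , refl ← ∈-∃++ (∈-resp-↭ (⟶*⇒↭ ts) n∈σ)
  = by-split (++-split p p′ pq≡p′q′)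
  where
  all<n : ∀ p {q} → Unique (p ++ n ∷ q) → All (_< suc n) (p ++ n ∷ q) → All (_< n) (p ++ q)
  all<n p {q} uq <1+n = <suc⇒< (All.tail (All-resp-↭ (shift n p q) <1+n)) (proj₁ (unique-drop-mid p uq))
  uq′ = unique-↭ (⟶*⇒↭ ts) uq
  <n  = all<n p uq <1+n
  <n′ = all<n p′ uq′ (All-resp-↭ (⟶*⇒↭ ts) <1+n)
  pq≡p′q′ : p ++ q ≡ p′ ++ q′
  pq≡p′q′ = Baxter-unique n (proj₂ (unique-drop-mid p uq)) <n
    (subst₂ _⟶*_ (erase-max p <n) (erase-max p′ <n′) (erase-⟶* (All.map ≤-pred <1+n) ts))
    (Baxter-remove-max p <n bxσ) (Baxter-remove-max p′ <n′ bxτ)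
  -- The two cuts of the common word enclose a factor `t`. If the second word has `n` further left,
  -- the exchanges are read backwards.
  by-split : (∃ λ t → (p′ ≡ p ++ t × q ≡ t ++ q′) ⊎ (p ≡ p′ ++ t × q′ ≡ t ++ q)) →
             p ++ n ∷ q ≡ p′ ++ n ∷ q′
  by-split (t , inj₁ (refl , refl))
    with refl ← Baxter-max-position p t q′ uq <n (ts ◅◅ ≡⇒⟶* (++-assoc p t _)) bxσ
                  (subst Baxter (++-assoc p t _) bxτ)
    = sym (++-assoc p [] _)
  by-split (t , inj₂ (refl , refl))
    with refl ← Baxter-max-position p′ t q uq′ <n′ (reverse ⟶-sym ts ◅◅ ≡⇒⟶* (++-assoc p′ t _)) bxτ
                  (subst Baxter (++-assoc p′ t _) bxσ)
    = ++-assoc p′ [] _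

-- Standardization and the patterns 2413 and 3142.

data SameOrder : Word → Word → Set where
  []  : SameOrder [] []
  _∷_ : Pointwise (λ x′ y′ → x > x′ ⇔ y > y′) u v → SameOrder u v → SameOrder (x ∷ u) (y ∷ v)

-- For four-letter words this reduces inversions of positions to a list of six comparisons of
-- letters.
SameOrder⇒SameInversions : SameOrder u v → SameInversions u v
SameOrder⇒SameInversions [] = refl , λ ()
SameOrder⇒SameInversions {_ ∷ u} {_ ∷ v} (hd ∷ tl) with eq , same ← SameOrder⇒SameInversions tl =
  cong suc eq , λ where
    zero    zero    → mk⇔ (λ ()) (λ ())
    zero    (suc j) → mk⇔ (λ (_ , inv) → z<s , Equivalence.to (at eq hd j) inv)
                          (λ (_ , inv) → z<s , Equivalence.from (at eq hd j) inv)
    (suc i) zero    → mk⇔ (λ ()) (λ ())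
    (suc i) (suc j) → mk⇔ (λ (i<j , inv) → map₁ s<s (Equivalence.to (same i j) (≤-pred i<j , inv)))
                          (λ (i<j , inv) → map₁ s<s (Equivalence.from (same i j) (≤-pred i<j , inv)))
  where
  at : ∀ {R : ℕ → ℕ → Set} {u v} .(eq : length u ≡ length v) → Pointwise R u v → ∀ j →
       R (lookup u j) (lookup v (cast eq j))
  at eq (r ∷ _)  zero    = r
  at eq (_ ∷ rs) (suc j) = at (suc-injective eq) rs j

both : ∀ {A B : Set} → A → B → A ⇔ B
both x y = mk⇔ (λ _ → y) (λ _ → x)

neither : ∀ {A B : Set} → ¬ A → ¬ B → A ⇔ B
neither ¬x ¬y = mk⇔ (λ x → contradiction x ¬x) (λ y → contradiction y ¬y)

std-2413 : ∀ {a b c d} → c < a → a < d → d < b → IsStd (a ∷ b ∷ c ∷ d ∷ []) [2413]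
std-2413 c<a a<d d<b =
  (refl , from-yes (unique? [2413]) , from-yes (All.all? (_<? 4) [2413])) ,
  SameOrder⇒SameInversions
    ((neither (<-asym a<b) (from-no (3 <? 1)) ∷ both c<a (from-yes (0 <? 1)) ∷ neither (<-asym a<d) (from-no (2 <? 1)) ∷ []) ∷
     (both (<-trans c<a a<b) (from-yes (0 <? 3)) ∷ both d<b (from-yes (2 <? 3)) ∷ []) ∷
     (neither (<-asym (<-trans c<a a<d)) (from-no (2 <? 0)) ∷ []) ∷ [] ∷ [])
  where a<b = <-trans a<d d<b

std-3142 : ∀ {a b c d} → b < d → d < a → a < c → IsStd (a ∷ b ∷ c ∷ d ∷ []) [3142]
std-3142 b<d d<a a<c =
  (refl , from-yes (unique? [3142]) , from-yes (All.all? (_<? 4) [3142])) ,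
  SameOrder⇒SameInversions
    ((both b<a (from-yes (0 <? 2)) ∷ neither (<-asym a<c) (from-no (3 <? 2)) ∷ both d<a (from-yes (1 <? 2)) ∷ []) ∷
     (neither (<-asym (<-trans b<a a<c)) (from-no (3 <? 0)) ∷ neither (<-asym b<d) (from-no (1 <? 0)) ∷ []) ∷
     (both (<-trans d<a a<c) (from-yes (1 <? 3)) ∷ []) ∷ [] ∷ [])
  where b<a = <-trans b<d d<a

IsBaxter⇒Baxter : IsBaxter σ → Baxter σ
IsBaxter⇒Baxter isBx p {l} {r} s {x} {y} refl x∈p y∈s =
  [ (λ (l<y , y<x , x<r) → isBx sub (p , s , refl) (std-3142 l<y y<x x<r) (there (here refl)))
  , (λ (r<x , x<y , y<l) → isBx sub (p , s , refl) (std-2413 r<x x<y y<l) (here refl)) ]′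
  where
  sub : x ∷ l ∷ r ∷ y ∷ [] ⊆ p ++ l ∷ r ∷ s
  sub = Sublist.++⁺ (from∈ x∈p) (refl ∷ refl ∷ from∈ y∈s)

-- Without repetition the subword must use the displayed `l r`, which places `x` in `p` and `y` in
-- `s`. Non-inversions yield only weak inequalities, and distinctness makes them strict.
Baxter⇒IsBaxter : Unique σ → Baxter σ → IsBaxter σ
Baxter⇒IsBaxter uq bx {x} {l} {r} {y} sub (p , s , refl) {π} (_ , eq , same) = avoids
  where
  x∈p : x ∈ p
  x∈p = unique-⊆⇒∈ˡ p uq (⊆-trans (refl ∷ refl ∷ minimum _) sub)
  y∈s : y ∈ s
  y∈s = unique-⊆⇒∈ʳ (p ∷ʳ l) (subst Unique (sym (++-assoc p _ _)) uq)
          (subst (_ ∷ _ ∷ [] ⊆_) (sym (++-assoc p _ _)) (⊆-trans (skip _ (skip _ (refl ∷ refl ∷ []))) sub))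
  xlry : Word
  xlry = x ∷ l ∷ r ∷ y ∷ []
  inverted : ∀ i j → Inversion π (cast eq i) (cast eq j) → lookup xlry i > lookup xlry j
  inverted i j inv = proj₂ (Equivalence.from (same i j) inv)
  ordered : ∀ i j → i Fin.< j → ¬ Inversion π (cast eq i) (cast eq j) → lookup xlry i ≤ lookup xlry j
  ordered i j i<j ¬inv = ≮⇒≥ λ inv → ¬inv (Equivalence.to (same i j) (i<j , inv))
  avoids : π ∉ [2413] ∷ [3142] ∷ []
  avoids (here refl) = bx p s refl x∈p y∈s (inj₂ (r<x , x<y , y<l))
    where
    r<x = inverted (# 0) (# 2) (z<s , from-yes (0 <? 1))
    x<y = ≤∧≢⇒< (ordered (# 0) (# 3) z<s (from-no (2 <? 1) ∘ proj₂))
                (unique-++⇒≢ p uq x∈p (there (there y∈s)))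
    y<l = inverted (# 1) (# 3) (s<s z<s , from-yes (2 <? 3))
  avoids (there (here refl)) = bx p s refl x∈p y∈s (inj₁ (l<y , y<x , x<r))
    where
    l<y = ≤∧≢⇒< (ordered (# 1) (# 3) (s<s z<s) (from-no (1 <? 0) ∘ proj₂))
                (λ { refl → unique-head-∉ (unique-++⁻ʳ p uq) (there y∈s) })
    y<x = inverted (# 0) (# 3) (z<s , from-yes (1 <? 2))
    x<r = ≤∧≢⇒< (ordered (# 0) (# 2) z<s (from-no (3 <? 2) ∘ proj₂))
                (unique-++⇒≢ p uq x∈p (there (here refl)))

-- Permutations and their equivalence classes.

permutation-↭ : ∀ {n} → σ ↭ τ → IsPermutation n σ → IsPermutation n τ
permutation-↭ σ↭τ (len , uq , <n) =
  trans (sym (↭-length σ↭τ)) len , unique-↭ σ↭τ uq , All-resp-↭ σ↭τ <n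

theorem4p14 : ∀ (n : ℕ) (σ : Word) → IsPermutation n σ →
    ∃! _≡_ (λ τ → σ ≡ᴮ τ × IsBaxterPermutation n τ)
theorem4p14 n σ perm@(_ , uq , <n) with τ , σ⟶*τ , bxτ ← Baxter-exists n uq <n =
  τ , (⟶*⇒≡ᴮ σ⟶*τ , permτ , Baxter⇒IsBaxter (proj₁ (proj₂ permτ)) bxτ) ,
  -- Exchanges lead from `τ` back to `σ` and on to the other Baxter permutation.
  λ (σ≡ᴮτ′ , _ , isBxτ′) →
    Baxter-unique n (proj₁ (proj₂ permτ)) (proj₂ (proj₂ permτ))
      (reverse ⟶-sym σ⟶*τ ◅◅ ≡ᴮ⇒⟶* σ≡ᴮτ′ uq) bxτ (IsBaxter⇒Baxter isBxτ′)
  where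
  permτ : IsPermutation n τ
  permτ = permutation-↭ (⟶*⇒↭ σ⟶*τ) perm
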